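{- Let $k\ge 2$. Given a $k$-DFAO $M$ generating a $k$-automatic sequence ${\bf a}$, each of the following properties is decidable (i.e., there is an algorithm which, given $M$ and the indicated additional parameters, decides the property): (a) given a rational number $r>1$, whether ${\bf a}$ avoids $r$-powers (resp., avoids $r^+$-powers); (b) given a rational number $r>1$, whether ${\bf a}$ contains infinitely many occurrences of $r$-powers (resp., $r^+$-powers); (c) given a rational number $r>1$, whether ${\bf a}$ contains infinitely many distinct $r$-powers (resp., $r^+$-powers); (d) given a rational number $r>1$ and a length $l$, whether ${\bf a}$ avoids all $r$-powers $x^r$ (resp., all $r^+$-powers) with period word $x$ satisfying $|x|\ge l$; (e) given a rational number $r>1$, whether ${\bf a}$ avoids $x^r$ for all sufficiently long $x$; (f) given a length $l$, whether ${\bf a}$ avoids (i.e., has no factor that is a) palindrome of length $\ge l$; (g) whether ${\bf a}$ avoids all sufficiently long palindromes; (h) given a length $l$, whether ${\bf a}$ has the property that whenever $x$ is a factor of ${\bf a}$ of length $\ge l$, its reversal $x^R$ is not a factor of ${\bf a}$; (i) assuming ${\bf a}$ is over the alphabet $\{0,1,\ldots,j-1\}$, whether ${\bf a}$ has no factor of the form $x\,\sigma(x)$ with $x$ nonempty, where $\sigma$ is the morphism defined by $\sigma(a)=(a+1)\bmod j$ on letters.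
   Context: A $k$-DFAO is a deterministic finite automaton with output $M=(Q,\Sigma_k,\Delta,\delta,q_0,\tau)$, $\Sigma_k=\{0,\ldots,k-1\}$, $\delta:Q\times\Sigma_k\to Q$, $\tau:Q\to\Delta$; it generates $(a_n)_{n\ge0}$ with $a_n=\tau(\delta(q_0,w^R))$ for any base-$k$ representation $w$ of $n$ (leading zeros allowed), $w^R$ the reversal of $w$. For a real $\alpha>1$, a word $z$ is an $\alpha$-power (written $x^\alpha$) if for some nonempty word $x$ it is the shortest prefix of $x^\omega=xxx\cdots$ of length $\ge\alpha|x|$; it is an $\alpha^+$-power if it is the shortest prefix of $x^\omega$ of length $>\alpha|x|$. A word or sequence contains an $\alpha$-power if some factor (contiguous block) of it is an $\alpha$-power, and avoids $\alpha$-powers otherwise (similarly for $\alpha^+$-powers). A palindrome is a word equal to its reversal. -}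

module Defs where

open import Data.Nat as ℕ using (ℕ; zero; suc; _+_; _*_; _∸_)
open import Data.Fin as Fin using (Fin; toℕ)
open import Data.Nat.DivMod using (_mod_)
open import Data.Integer using (+_)
open import Data.Rational as ℚ using (ℚ; _/_)
open import Data.List using (List; []; _∷_; map; upTo; length; take; concat; replicate; foldl; reverse)
open import Data.List.Membership.Propositional using (_∉_)
open import Data.Product using (Σ; ∃; ∃-syntax; _×_; _,_)
open import Relation.Binary.PropositionalEquality using (_≡_; _≢_)
open import Relation.Nullary using (¬_)

record DFAO (k d : ℕ) : Set where
  field
    nQ : ℕ
    δ  : Fin nQ → Fin k → Fin nQ
    q₀ : Fin nQ
    τ  : Fin nQ → Fin d

δ* : ∀ {k d} (M : DFAO k d) → Fin (DFAO.nQ M) → List (Fin k) → Fin (DFAO.nQ M)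
δ* M q w = foldl (DFAO.δ M) q w

-- value of a base-k digit string, most significant digit first
-- (leading zeros allowed)
val : ∀ {k} → List (Fin k) → ℕ
val {k} w = foldl (λ acc c → acc * k + toℕ c) 0 w

Generates : ∀ {k d} → DFAO k d → (ℕ → Fin d) → Set
Generates {k} M a = ∀ (n : ℕ) (w : List (Fin k)) → val w ≡ n →
  a n ≡ DFAO.τ M (δ* M (DFAO.q₀ M) (reverse w))

module _ {A : Set} where

  factorAt : (ℕ → A) → ℕ → ℕ → List A
  factorAt a i L = map (λ j → a (i + j)) (upTo L)

  IsFactor : (ℕ → A) → List A → Set
  IsFactor a w = ∃[ i ] (w ≡ factorAt a i (length w))

  -- prefix of length L of x^ω (meaningful for nonempty x)
  ωPrefix : List A → ℕ → List A
  ωPrefix x L = take L (concat (replicate L x))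

  -- z is an r-power with period word x: z is the shortest prefix of x^ω
  -- of length ≥ r|x|
  IsPowerOf : ℚ → List A → List A → Set
  IsPowerOf r x z =
    x ≢ [] × z ≡ ωPrefix x (length z)
    × (r ℚ.* (+ length x / 1)) ℚ.≤ (+ length z / 1)
    × (+ (length z ∸ 1) / 1) ℚ.< (r ℚ.* (+ length x / 1))

  -- z is an r⁺-power with period word x: the shortest prefix of x^ω
  -- of length > r|x|
  IsPowerPlusOf : ℚ → List A → List A → Set
  IsPowerPlusOf r x z =
    x ≢ [] × z ≡ ωPrefix x (length z)
    × (r ℚ.* (+ length x / 1)) ℚ.< (+ length z / 1)
    × (+ (length z ∸ 1) / 1) ℚ.≤ (r ℚ.* (+ length x / 1))

  IsPower : ℚ → List A → Set
  IsPower r z = ∃[ x ] IsPowerOf r x z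

  IsPowerPlus : ℚ → List A → Set
  IsPowerPlus r z = ∃[ x ] IsPowerPlusOf r x z

  Contains : (ℕ → A) → (List A → Set) → Set
  Contains a P = ∃[ w ] (IsFactor a w × P w)

  Avoids : (ℕ → A) → (List A → Set) → Set
  Avoids a P = ¬ Contains a P

  Occurrence : (ℕ → A) → (List A → Set) → ℕ × ℕ → Set
  Occurrence a P (i , L) = P (factorAt a i L)

  IsPalindrome : List A → Set
  IsPalindrome w = reverse w ≡ w

Infinite : {X : Set} → (X → Set) → Set
Infinite {X} P = ∀ (l : List X) → ∃[ x ] (P x × x ∉ l)

σ : ∀ {j} → Fin j → Fin j
σ {suc m} b = suc (toℕ b) mod suc m

σ* : ∀ {j} → List (Fin j) → List (Fin j)
σ* = map σ

{-# OPTIONS --safe #-}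
module Submission where

-- Büchi's method.  A relation on tuples of numbers is recognised by an automaton
-- reading base-k digits, least significant first, iff it belongs to a finite family
-- of relations closed under the passages from R(ρ) to R(c + kρ), c a tuple of digits.
-- Such relations are closed under the Boolean connectives (products), quantification
-- (the subset construction) and substitution; addition and the letters of a are among
-- them, and membership of a tuple is decidable.  Each of the nine properties is first
-- order over addition and a, because factors are intervals of positions: a power of
-- exponent r > 1 starts with its period word, so it is an interval with a period, and
-- a predicate on factors holds infinitely often iff it holds beyond every bound.

open import Defs
open import Data.Bool using (if_then_else_)
open import Data.Empty using (⊥)
open import Data.Fin as Fin using (Fin; toℕ; combine; remQuot; finToFun; funToFin)
open import Data.Fin.Patterns
open import Data.Fin.Properties as Fin using (any?)
open import Data.Integer as ℤ using (-[1+_])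
import Data.Integer.Properties as ℤ
open import Data.List as List
  using (List; []; _∷_; _++_; length; take; drop; concat; foldl; foldr; reverse;
         applyUpTo; upTo; allFin; cartesianProduct; cartesianProductWith)
open import Data.List.Membership.Propositional using (_∈_)
open import Data.List.Membership.Propositional.Properties
  using (∈-map⁺; ∈-upTo⁺; ∈-allFin; ∈-cartesianProduct⁺; ∈-cartesianProductWith⁺)
import Data.List.Properties as List
import Data.List.Relation.Unary.All as ListAll
open import Data.List.Relation.Unary.Any using (here; there)
open import Data.Maybe using (Maybe; just; nothing)
open import Data.Maybe.Properties using (just-injective)
open import Data.Nat as ℕ using (ℕ; zero; suc; _+_; _*_; _∸_; _⊓_; _≤_; _<_; z≤n; s≤s; s≤s⁻¹)
open import Data.Nat.Coprimality using (Coprime)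
open import Data.Nat.DivMod using (_/_; _mod_; _divMod_; DivMod; m/n<m)
open import Data.Nat.Induction using (<-rec)
open import Data.Nat.Properties as ℕ
open import Data.Nat.Solver using (module +-*-Solver)
open import Data.Product using (∃; ∃-syntax; ∃₂; _×_; _,_; proj₁; proj₂; uncurry; map₂)
open import Data.Product.Function.NonDependent.Propositional using (_×-⇔_)
open import Data.Rational as ℚ using (ℚ; mkℚ; 1ℚ; toℚᵘ)
import Data.Rational.Properties as ℚ
open import Data.Rational.Unnormalised as ℚᵘ using (mkℚᵘ; *≡*; *≤*; *<*)
import Data.Rational.Unnormalised.Properties as ℚᵘ
open import Data.Sum using (_⊎_; inj₁; inj₂; [_,_])
open import Data.Vec as Vec using (Vec; []; _∷_; zipWith; replicate; lookup; head; tail)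
open import Data.Vec.Properties using (lookup-zipWith; lookup-replicate)
open import Data.Vec.Relation.Unary.All as All using (All; []; _∷_)
open import Function using (_∘_; id; _⇔_; mk⇔; Equivalence)
open import Function.Construct.Composition using (_⇔-∘_)
open import Function.Construct.Identity using (⇔-id)
open import Function.Construct.Symmetry using (⇔-sym)
open import Data.List.Extrema ℕ.≤-totalOrder using (max; xs≤max)
open import Relation.Binary.PropositionalEquality hiding ([_])
open import Relation.Nullary using (¬_; Dec; yes; no; does; contradiction)
open import Relation.Nullary.Decidable as Dec using (_×-dec_; ¬?; decidable-stable)
open import Relation.Unary using (Decidable)

open Equivalence using (to; from)

-- Reachability in finite graphs

module _ {m D : ℕ} (step : Fin m → Fin D → Fin m) where

  -- Among the first `m + 1` prefixes of `w` two lead to the same state by the pigeonhole principle;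
  -- the segment between them can be cut out.
  shorten : ∀ i (w : List (Fin D)) → m ≤ length w →
            ∃[ w′ ] (length w′ < length w × foldl step i w′ ≡ foldl step i w)
  shorten i w m≤∣w∣
    with p , q , p<q , eq ← Fin.pigeonhole (s≤s m≤∣w∣) (λ p → foldl step i (take (toℕ p) w)) =
      take (toℕ p) w ++ drop (toℕ q) w , shorter , same
    where
    shorter : length (take (toℕ p) w ++ drop (toℕ q) w) < length w
    shorter = let open ≤-Reasoning in begin-strict
      length (take (toℕ p) w ++ drop (toℕ q) w)       ≡⟨ List.length-++ (take (toℕ p) w) ⟩
      length (take (toℕ p) w) + length (drop (toℕ q) w)
        ≡⟨ cong₂ _+_ (List.length-take (toℕ p) w) (List.length-drop (toℕ q) w) ⟩
      (toℕ p ⊓ length w) + (length w ∸ toℕ q)          ≤⟨ +-monoˡ-≤ _ (m⊓n≤m (toℕ p) _) ⟩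
      toℕ p + (length w ∸ toℕ q)                       <⟨ +-monoˡ-< _ p<q ⟩
      toℕ q + (length w ∸ toℕ q)                       ≡⟨ m+[n∸m]≡n (s≤s⁻¹ (Fin.toℕ<n q)) ⟩
      length w                                         ∎
    same : foldl step i (take (toℕ p) w ++ drop (toℕ q) w) ≡ foldl step i w
    same = let open ≡-Reasoning in begin
      foldl step i (take (toℕ p) w ++ drop (toℕ q) w)  ≡⟨ List.foldl-++ step i (take (toℕ p) w) _ ⟩
      foldl step (foldl step i (take (toℕ p) w)) (drop (toℕ q) w)
        ≡⟨ cong (λ s → foldl step s (drop (toℕ q) w)) eq ⟩
      foldl step (foldl step i (take (toℕ q) w)) (drop (toℕ q) w)
        ≡⟨ List.foldl-++ step i (take (toℕ q) w) _ ⟨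
      foldl step i (take (toℕ q) w ++ drop (toℕ q) w)  ≡⟨ cong (foldl step i) (List.take++drop≡id (toℕ q) w) ⟩
      foldl step i w                                   ∎

  short : ∀ i w → ∃[ w′ ] (length w′ < m × foldl step i w′ ≡ foldl step i w)
  short i w = <-rec (λ n → ∀ w → length w ≡ n → ∃[ w′ ] (length w′ < m × foldl step i w′ ≡ foldl step i w))
                    descend (length w) w refl
    where
    descend : ∀ n → (∀ {n′} → n′ < n → ∀ w → length w ≡ n′ →
                      ∃[ w′ ] (length w′ < m × foldl step i w′ ≡ foldl step i w)) →
              ∀ w → length w ≡ n → ∃[ w′ ] (length w′ < m × foldl step i w′ ≡ foldl step i w)
    descend _ rec w refl with length w ℕ.<? m
    ... | yes ∣w∣<m = w , ∣w∣<m , refl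
    ... | no ∣w∣≮m with w₁ , lt , eq ← shorten i w (≮⇒≥ ∣w∣≮m)
                   with w₂ , lt₂ , eq₂ ← rec lt w₁ refl = w₂ , lt₂ , trans eq₂ eq

  module _ {P : Fin m → Set} (P? : Decidable P) where

    reachableWithin? : ∀ n i → Dec (∃[ w ] (length w < n × P (foldl step i w)))
    reachableWithin? zero    i = no λ { (_ , () , _) }
    reachableWithin? (suc n) i with P? i | any? (λ c → reachableWithin? n (step i c))
    ... | yes p | _                   = yes ([] , s≤s z≤n , p)
    ... | no _  | yes (c , w , l , p) = yes (c ∷ w , s≤s l , p)
    ... | no ¬p | no ¬q               = no λ where
      ([]    , _ , p) → ¬p p
      (c ∷ w , l , p) → ¬q (c , w , s≤s⁻¹ l , p)

    -- By `short`, searching the finitely many words shorter than the number of states is enough.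
    reachable? : ∀ i → Dec (∃[ w ] P (foldl step i w))
    reachable? i = Dec.map′ (λ (w , _ , p) → w , p)
      (λ (w , p) → let w′ , l , eq = short i w in w′ , l , subst P (sym eq) p)
      (reachableWithin? m i)

characteristic : ∀ {m} {P : Fin m → Set} → Decidable P → Fin m → Fin 2
characteristic P? i = if does (P? i) then 1F else 0F

-- Subsets are numbered through their characteristic functions, so that the subset construction
-- again has a state set of the form `Fin`.
fromDec : ∀ {m} {P : Fin m → Set} → Decidable P → Fin (2 ℕ.^ m)
fromDec P? = funToFin (characteristic P?)

infix 4 _∈ₛ_

_∈ₛ_ : ∀ {m} → Fin m → Fin (2 ℕ.^ m) → Set
i ∈ₛ s = finToFun s i ≡ 1F

∈-fromDec : ∀ {m} {P : Fin m → Set} (P? : Decidable P) i → i ∈ₛ fromDec P? ⇔ P i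
∈-fromDec P? i rewrite Fin.finToFun-funToFin (characteristic P?) i
  with P? i
... | yes p = mk⇔ (λ _ → p) (λ _ → refl)
... | no ¬p = mk⇔ (λ ()) (λ p → contradiction p ¬p)

-- Automatic relations

module Automata (b : ℕ) where

  k : ℕ
  k = suc (suc b)

  infixr 6 _⊕_ _⊕₁_

  _⊕₁_ : Fin k → ℕ → ℕ
  c ⊕₁ x = toℕ c + x * k

  _⊕_ : ∀ {n} → Vec (Fin k) n → Vec ℕ n → Vec ℕ n
  _⊕_ = zipWith _⊕₁_

  zeros-⊕ : ∀ n → replicate n 0F ⊕ replicate n 0 ≡ replicate n 0
  zeros-⊕ zero    = refl
  zeros-⊕ (suc n) = cong (0 ∷_) (zeros-⊕ n)

  -- The sum of the entries bounds each of them and serves as fuel: `k` is at least 2, so division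
  -- by `k` lowers every nonzero entry, and the common bound drops by one with each tuple of digits
  -- removed.
  digit-induction : ∀ {n} (C : Vec ℕ n → Set) → C (replicate n 0) →
                    (∀ c ρ → C ρ → C (c ⊕ ρ)) → ∀ ρ → C ρ
  digit-induction {n} C C0 C⊕ ρ = go (Vec.sum ρ) ρ (bounded ρ)
    where
    bounded : ∀ {n} (ρ : Vec ℕ n) → All (_≤ Vec.sum ρ) ρ
    bounded []      = []
    bounded (x ∷ ρ) = m≤m+n x _ ∷ All.map (λ le → ≤-trans le (m≤n+m _ x)) (bounded ρ)

    all-zero : ∀ {n} {ρ : Vec ℕ n} → All (_≤ 0) ρ → ρ ≡ replicate n 0
    all-zero []        = refl
    all-zero (z≤n ∷ h) = cong (0 ∷_) (all-zero h)

    split : ∀ {n} (ρ : Vec ℕ n) → ρ ≡ Vec.map (_mod k) ρ ⊕ Vec.map (_/ k) ρ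
    split []      = refl
    split (x ∷ ρ) = cong₂ _∷_ (DivMod.property (x divMod k)) (split ρ)

    x/k≤ : ∀ {N x} → x ≤ suc N → x / k ≤ N
    x/k≤ {x = zero}  _  = z≤n
    x/k≤ {x = suc x} le = s≤s⁻¹ (≤-trans (m/n<m (suc x) k (s≤s (s≤s z≤n))) le)

    halve : ∀ {n N} {ρ : Vec ℕ n} → All (_≤ suc N) ρ → All (_≤ N) (Vec.map (_/ k) ρ)
    halve []       = []
    halve (le ∷ h) = x/k≤ le ∷ halve h

    go : ∀ N ρ → All (_≤ N) ρ → C ρ
    go zero    ρ h = subst C (sym (all-zero h)) C0
    go (suc N) ρ h = subst C (sym (split ρ)) (C⊕ _ _ (go N _ (halve h)))

  digit-induction₁ : (C : ℕ → Set) → C 0 → (∀ c x → C x → C (c ⊕₁ x)) → ∀ x → C x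
  digit-induction₁ C C0 C⊕ x =
    digit-induction (C ∘ head) C0 (λ { (c ∷ []) (x ∷ []) → C⊕ c x }) (x ∷ [])

  -- Lang i is the relation recognised from state i.  It is semantic, so leading zeros
  -- need no separate treatment: Lang-step at ρ = 0 makes them harmless.
  record Automatic {n} (R : Vec ℕ n → Set) : Set₁ where
    field
      size  : ℕ
      init  : Fin size
      step  : Fin size → Vec (Fin k) n → Fin size
      Lang  : Fin size → Vec ℕ n → Set
      Lang-init : ∀ ρ → Lang init ρ ⇔ R ρ
      Lang-step : ∀ i c ρ → Lang (step i c) ρ ⇔ Lang i (c ⊕ ρ)
      Lang-0?   : ∀ i → Dec (Lang i (replicate n 0))

  open Automatic

  -- The automaton is run on the digits of `ρ`. The induction covers all states at once, since
  -- removing a digit changes the state.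
  dec : ∀ {n} {R : Vec ℕ n → Set} → Automatic R → ∀ ρ → Dec (R ρ)
  dec A ρ = Dec.map (A .Lang-init ρ)
    (digit-induction (λ ρ → ∀ i → Dec (A .Lang i ρ)) (A .Lang-0?)
      (λ c ρ h i → Dec.map (A .Lang-step i c ρ) (h (A .step i c))) ρ (A .init))

  respᴬ : ∀ {n} {R S : Vec ℕ n → Set} → (∀ ρ → R ρ ⇔ S ρ) → Automatic R → Automatic S
  respᴬ R⇔S A = record
    { size = A .size ; init = A .init ; step = A .step ; Lang = A .Lang
    ; Lang-init = λ ρ → R⇔S ρ ⇔-∘ A .Lang-init ρ
    ; Lang-step = A .Lang-step ; Lang-0? = A .Lang-0? }

  infix  0 ∃ᴬ_ ∀ᴬ_
  infix  9 ¬ᴬ_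
  infixr 3 _∧ᴬ_
  infixr 2 _∨ᴬ_
  infixr 1 _⇒ᴬ_

  ¬-cong : ∀ {A B : Set} → A ⇔ B → (¬ A) ⇔ (¬ B)
  ¬-cong e = mk⇔ (_∘ from e) (_∘ to e)

  ¬ᴬ_ : ∀ {n} {R : Vec ℕ n → Set} → Automatic R → Automatic (λ ρ → ¬ R ρ)
  ¬ᴬ A = record
    { size = A .size ; init = A .init ; step = A .step ; Lang = λ i ρ → ¬ A .Lang i ρ
    ; Lang-init = λ ρ → ¬-cong (A .Lang-init ρ)
    ; Lang-step = λ i c ρ → ¬-cong (A .Lang-step i c ρ)
    ; Lang-0? = λ i → ¬? (A .Lang-0? i) }

  _∧ᴬ_ : ∀ {n} {R S : Vec ℕ n → Set} → Automatic R → Automatic S → Automatic (λ ρ → R ρ × S ρ)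
  _∧ᴬ_ {n} {R} {S} A B = record
    { size = A .size * B .size
    ; init = combine (A .init) (B .init)
    ; step = λ s c → uncurry (λ i j → combine (A .step i c) (B .step j c)) (unpair s)
    ; Lang = λ s ρ → L (unpair s) ρ
    ; Lang-init = λ ρ → (A .Lang-init ρ ×-⇔ B .Lang-init ρ) ⇔-∘ pair-L (A .init) (B .init) ρ
    ; Lang-step = λ s c ρ → let i , j = unpair s in
        (A .Lang-step i c ρ ×-⇔ B .Lang-step j c ρ) ⇔-∘ pair-L (A .step i c) (B .step j c) ρ
    ; Lang-0? = λ s → let i , j = unpair s in A .Lang-0? i ×-dec B .Lang-0? j }
    where
    unpair : Fin (A .size * B .size) → Fin (A .size) × Fin (B .size)
    unpair = remQuot (B .size)
    L : Fin (A .size) × Fin (B .size) → Vec ℕ n → Set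
    L (i , j) ρ = A .Lang i ρ × B .Lang j ρ
    pair-L : ∀ i j ρ → L (unpair (combine i j)) ρ ⇔ L (i , j) ρ
    pair-L i j ρ = subst (λ s → L s ρ ⇔ L (i , j) ρ) (sym (Fin.remQuot-combine i j)) (⇔-id _)

  -- The classical rendering of implication is valid constructively because `S` is decidable.
  _⇒ᴬ_ : ∀ {n} {R S : Vec ℕ n → Set} → Automatic R → Automatic S → Automatic (λ ρ → R ρ → S ρ)
  A ⇒ᴬ B = respᴬ (λ ρ → mk⇔ (λ h r → decidable-stable (dec B ρ) (λ ¬s → h (r , ¬s)))
                           (λ h (r , ¬s) → ¬s (h r)))
                (¬ᴬ (A ∧ᴬ ¬ᴬ B))

  _∨ᴬ_ : ∀ {n} {R S : Vec ℕ n → Set} → Automatic R → Automatic S → Automatic (λ ρ → R ρ ⊎ S ρ)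
  _∨ᴬ_ {R = R} {S} A B = respᴬ (λ ρ → mk⇔ (classical ρ) [ (λ r ¬r → contradiction r ¬r) , (λ s _ → s) ])
                (¬ᴬ A ⇒ᴬ B)
    where
    classical : ∀ ρ → (¬ R ρ → S ρ) → R ρ ⊎ S ρ
    classical ρ h with dec A ρ
    ... | yes r = inj₁ r
    ... | no ¬r = inj₂ (h ¬r)

  -- The digits of `y` are guessed: a set of states recognises the union of their relations, and a
  -- step collects the successors over all digits of `y`. As `y` may be longer than every entry of
  -- `ρ`, membership at zero is a reachability question.
  ∃ᴬ_ : ∀ {n} {R : Vec ℕ (suc n) → Set} → Automatic R → Automatic (λ ρ → ∃[ y ] R (y ∷ ρ))
  ∃ᴬ_ {n} {R} A = record
    { size = 2 ℕ.^ A .size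
    ; init = fromDec (Fin._≟ A .init)
    ; step = step′
    ; Lang = Lang′
    ; Lang-init = λ ρ → mk⇔
        (λ (i , i∈ , y , l) → y , to (A .Lang-init (y ∷ ρ))
          (subst (λ i → A .Lang i (y ∷ ρ)) (to (∈-fromDec (Fin._≟ A .init) i) i∈) l))
        (λ (y , r) → A .init , from (∈-fromDec (Fin._≟ A .init) (A .init)) refl , y , from (A .Lang-init (y ∷ ρ)) r)
    ; Lang-step = λ s c ρ → mk⇔ (forth s c ρ) (back s c ρ)
    ; Lang-0? = λ s → any? λ i → (finToFun s i Fin.≟ 1F) ×-dec exists-0? i }
    where
    Lang′ : Fin (2 ℕ.^ A .size) → Vec ℕ n → Set
    Lang′ s ρ = ∃[ i ] (i ∈ₛ s × ∃[ y ] A .Lang i (y ∷ ρ))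

    succ? : ∀ s (c : Vec (Fin k) n) (j : Fin (A .size)) → Dec (∃[ i ] (i ∈ₛ s × ∃[ e ] A .step i (e ∷ c) ≡ j))
    succ? s c j = any? λ i → (finToFun s i Fin.≟ 1F) ×-dec any? λ e → A .step i (e ∷ c) Fin.≟ j

    step′ : Fin (2 ℕ.^ A .size) → Vec (Fin k) n → Fin (2 ℕ.^ A .size)
    step′ s c = fromDec (succ? s c)

    forth : ∀ s c ρ → Lang′ (step′ s c) ρ → Lang′ s (c ⊕ ρ)
    forth s c ρ (j , j∈ , y , l) with i , i∈ , e , refl ← to (∈-fromDec (succ? s c) j) j∈ =
      i , i∈ , e ⊕₁ y , to (A .Lang-step i (e ∷ c) (y ∷ ρ)) l

    back : ∀ s c ρ → Lang′ s (c ⊕ ρ) → Lang′ (step′ s c) ρ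
    -- The induction serves only to split `y` into its lowest digit and the rest; 0 splits as digit
    -- 0 and rest 0.
    back s c ρ (i , i∈ , y , l) = digit-induction₁ C (λ i i∈ l → split 0F 0 i i∈ l) (λ e y _ → split e y) y i i∈ l
      where
      C : ℕ → Set
      C y = ∀ i → i ∈ₛ s → A .Lang i (y ∷ (c ⊕ ρ)) → Lang′ (step′ s c) ρ
      split : ∀ e y → C (e ⊕₁ y)
      split e y i i∈ l = A .step i (e ∷ c) , from (∈-fromDec (succ? s c) _) (i , i∈ , e , refl)
                       , y , from (A .Lang-step i (e ∷ c) (y ∷ ρ)) l

    -- Once the entries of `ρ` are exhausted they contribute zeros only, and the moves are labelled
    -- by the remaining digits of `y`.
    step₀ : Fin (A .size) → Fin k → Fin (A .size)
    step₀ i e = A .step i (e ∷ replicate n 0F)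

    step₀-Lang : ∀ i e y → A .Lang (step₀ i e) (y ∷ replicate n 0) ⇔ A .Lang i (e ⊕₁ y ∷ replicate n 0)
    step₀-Lang i e y = subst (λ ρ → A .Lang (step₀ i e) (y ∷ replicate n 0) ⇔ A .Lang i (e ⊕₁ y ∷ ρ))
      (zeros-⊕ n) (A .Lang-step i (e ∷ replicate n 0F) (y ∷ replicate n 0))

    exists-0? : ∀ i → Dec (∃[ y ] A .Lang i (y ∷ replicate n 0))
    exists-0? i = Dec.map′ (λ (w , l) → word⇒number w i l) (λ (y , l) → number⇒word y i l)
                           (reachable? step₀ (A .Lang-0?) i)
      where
      word⇒number : ∀ w i → A .Lang (foldl step₀ i w) (0 ∷ replicate n 0) → ∃[ y ] A .Lang i (y ∷ replicate n 0)
      word⇒number []      i l = 0 , l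
      word⇒number (e ∷ w) i l with y , l′ ← word⇒number w (step₀ i e) l = e ⊕₁ y , to (step₀-Lang i e y) l′
      number⇒word : ∀ y i → A .Lang i (y ∷ replicate n 0) →
                    ∃[ w ] A .Lang (foldl step₀ i w) (0 ∷ replicate n 0)
      number⇒word = digit-induction₁
        (λ y → ∀ i → A .Lang i (y ∷ replicate n 0) → ∃[ w ] A .Lang (foldl step₀ i w) (0 ∷ replicate n 0))
        (λ i l → [] , l) λ e y ih i l →
        let w , l′ = ih (step₀ i e) (from (step₀-Lang i e y) l) in e ∷ w , l′

  ∀ᴬ_ : ∀ {n} {R : Vec ℕ (suc n) → Set} → Automatic R → Automatic (λ ρ → ∀ y → R (y ∷ ρ))
  ∀ᴬ A = respᴬ (λ ρ → mk⇔ (λ h y → decidable-stable (dec A (y ∷ ρ)) (λ ¬r → h (y , ¬r)))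
                         (λ h (y , ¬r) → ¬r (h y)))
              (¬ᴬ (∃ᴬ (¬ᴬ A)))

  -- A natural family of maps Vec A m → Vec A n acts on tuples of numbers
  -- and on tuples of digits alike, hence commutes with _⊕_.
  preimage : ∀ {m n} {R : Vec ℕ n → Set} (h : ∀ {A : Set} → Vec A m → Vec A n) →
             (∀ {A B C : Set} (f : A → B → C) xs ys → h (zipWith f xs ys) ≡ zipWith f (h xs) (h ys)) →
             (∀ {A : Set} (x : A) → h (replicate m x) ≡ replicate n x) →
             Automatic R → Automatic (λ ρ → R (h ρ))
  preimage h h-zipWith h-replicate A = record
    { size = A .size ; init = A .init
    ; step = λ i c → A .step i (h c)
    ; Lang = λ i ρ → A .Lang i (h ρ)
    ; Lang-init = λ ρ → A .Lang-init (h ρ)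
    ; Lang-step = λ i c ρ → subst (λ ρ′ → A .Lang (A .step i (h c)) (h ρ) ⇔ A .Lang i ρ′)
                                   (sym (h-zipWith _⊕₁_ c ρ)) (A .Lang-step i (h c) (h ρ))
    ; Lang-0? = λ i → subst (λ ρ → Dec (A .Lang i ρ)) (sym (h-replicate 0)) (A .Lang-0? i) }

  -- Choosing coordinates covers permuting, repeating and dropping variables.
  select : ∀ {m n} {R : Vec ℕ n → Set} (is : Vec (Fin m) n) →
           Automatic R → Automatic (λ ρ → R (Vec.map (lookup ρ) is))
  select is = preimage (λ ρ → Vec.map (lookup ρ) is) (λ f xs ys → zips f xs ys is) (λ x → replicates x is)
    where
    zips : ∀ {m n} {A B C : Set} (f : A → B → C) xs ys (is : Vec (Fin m) n) →
           Vec.map (lookup (zipWith f xs ys)) is ≡ zipWith f (Vec.map (lookup xs) is) (Vec.map (lookup ys) is)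
    zips f xs ys []       = refl
    zips f xs ys (i ∷ is) = cong₂ _∷_ (lookup-zipWith f i xs ys) (zips f xs ys is)
    replicates : ∀ {m n} {A : Set} (x : A) (is : Vec (Fin m) n) →
                 Vec.map (lookup (replicate m x)) is ≡ replicate n x
    replicates x []       = refl
    replicates x (i ∷ is) = cong₂ _∷_ (lookup-replicate i x) (replicates x is)

  constᴬ : ∀ {n} {P : Set} → Dec P → Automatic {n} (λ _ → P)
  constᴬ {P = P} P? = record { size = 1 ; init = 0F ; step = λ _ _ → 0F ; Lang = λ _ _ → P
              ; Lang-init = λ _ → ⇔-id _ ; Lang-step = λ _ _ _ → ⇔-id _ ; Lang-0? = λ _ → P? }

  ⋁ᴬ : ∀ {n d} {R : Fin d → Vec ℕ n → Set} → (∀ e → Automatic (R e)) → Automatic (λ ρ → ∃[ e ] R e ρ)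
  ⋁ᴬ {d = zero}  A = respᴬ (λ _ → mk⇔ (λ ()) (λ ())) (constᴬ (no id))
  ⋁ᴬ {d = suc d} A = respᴬ (λ _ → Fin.⊎⇔∃) (A Fin.zero ∨ᴬ ⋁ᴬ (A ∘ Fin.suc))

-- Addition, order and linear terms

module Arithmetic (b : ℕ) where

  open Automata b

  -- The states of the column adder: no incoming carry, incoming carry 1, and a sink entered after a
  -- wrong digit.
  carry : Fin 3 → ℕ → ℕ → ℕ → Set
  carry 0F x y z = x + y ≡ z
  carry 1F x y z = suc (x + y) ≡ z
  carry 2F x y z = ⊥

  -- The bounds put `s - e` strictly between `-k` and `2k`, so this multiple of `k` is 0 or `k`. The
  -- induction cancels one `k` on both sides until `X` or `z` is 0.
  digit-sum : ∀ s e X z → s < k + k → e < k → s + X * k ≡ e + z * k →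
              (s ≡ e × X ≡ z) ⊎ (s ≡ e + k × suc X ≡ z)
  digit-sum s e zero    zero    _ _ eq = inj₁ (+-cancelʳ-≡ 0 s e eq , refl)
  digit-sum s e zero    (suc zero) _ _ eq =
    inj₂ (trans (sym (+-identityʳ s)) (trans eq (cong (e +_) (+-identityʳ k))) , refl)
  digit-sum s e zero    (suc (suc z)) s<2k _ eq = contradiction s<2k (≤⇒≯ (begin
    k + k               ≤⟨ +-monoʳ-≤ k (m≤m+n k (z * k)) ⟩
    k + (k + z * k)     ≤⟨ m≤n+m _ e ⟩
    e + suc (suc z) * k ≡⟨ eq ⟨
    s + 0               ≡⟨ +-identityʳ s ⟩
    s                   ∎))
    where open ≤-Reasoning
  digit-sum s e (suc X) zero    _ e<k eq = contradiction e<k (≤⇒≯ (begin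
    k             ≤⟨ m≤m+n k (X * k) ⟩
    k + X * k     ≤⟨ m≤n+m _ s ⟩
    s + suc X * k ≡⟨ eq ⟩
    e + 0         ≡⟨ +-identityʳ e ⟩
    e             ∎))
    where open ≤-Reasoning
  digit-sum s e (suc X) (suc z) s<2k e<k eq
    with digit-sum s e X z s<2k e<k (+-cancelˡ-≡ k _ _ (trans (x∙yz≈y∙xz k s _) (trans eq (x∙yz≈y∙xz e k _))))
    where open import Algebra.Properties.CommutativeSemigroup +-commutativeSemigroup
  ... | inj₁ (p , q) = inj₁ (p , cong suc q)
  ... | inj₂ (p , q) = inj₂ (p , cong suc q)

  next-carry : ∀ s e → s < k + k → e < k →
               ∃[ i ] ∀ x y z → carry i x y z ⇔ (s + (x + y) * k ≡ e + z * k)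
  next-carry s e s<2k e<k with s ℕ.≟ e | s ℕ.≟ e + k
  ... | yes refl | _ = 0F , λ x y z → mk⇔ (λ eq → cong (λ n → s + n * k) eq)
                         (λ eq → *-cancelʳ-≡ (x + y) z k (+-cancelˡ-≡ s _ _ eq))
  ... | no _ | yes refl = 1F , λ x y z → mk⇔ (λ { refl → +-assoc e k _ })
                         (λ eq → *-cancelʳ-≡ (suc (x + y)) z k (+-cancelˡ-≡ e _ _ (trans (sym (+-assoc e k _)) eq)))
  ... | no s≢e | no s≢e+k = 2F , λ x y z → mk⇔ (λ ())
                         ([ s≢e ∘ proj₁ , s≢e+k ∘ proj₁ ] ∘ digit-sum s e (x + y) z s<2k e<k)

  carry-automatic : ∀ i → Automatic {3} (λ { (x ∷ y ∷ z ∷ []) → carry i x y z })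
  carry-automatic i = record
    { size = 3 ; init = i
    ; step = λ { i (c ∷ d ∷ e ∷ []) → step′ i c d e }
    ; Lang = λ { i (x ∷ y ∷ z ∷ []) → carry i x y z }
    ; Lang-init = λ { (x ∷ y ∷ z ∷ []) → ⇔-id _ }
    ; Lang-step = λ { i (c ∷ d ∷ e ∷ []) (x ∷ y ∷ z ∷ []) → law i c d e x y z }
    ; Lang-0? = λ { 0F → yes refl ; 1F → no λ () ; 2F → no λ () } }
    where
    -- Two digits and a carry add up to at most `2k - 1`, so the outgoing carry is again 0 or 1.
    c+d< : ∀ (c d : Fin k) → suc (toℕ c + toℕ d) < k + k
    c+d< c d = subst (_≤ k + k) (cong suc (+-suc _ _)) (+-mono-≤ (Fin.toℕ<n c) (Fin.toℕ<n d))

    next₀ next₁ : ∀ (c d e : Fin k) → _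
    next₀ c d e = next-carry (toℕ c + toℕ d) (toℕ e) (<-trans (n<1+n _) (c+d< c d)) (Fin.toℕ<n e)
    next₁ c d e = next-carry (suc (toℕ c + toℕ d)) (toℕ e) (c+d< c d) (Fin.toℕ<n e)

    step′ : Fin 3 → Fin k → Fin k → Fin k → Fin 3
    step′ 0F c d e = proj₁ (next₀ c d e)
    step′ 1F c d e = proj₁ (next₁ c d e)
    step′ 2F c d e = 2F

    regroup : ∀ c x d y → (c + d) + (x + y) * k ≡ (c + x * k) + (d + y * k)
    regroup c x d y = solve 5 (λ c x d y k → (c :+ d) :+ (x :+ y) :* k := (c :+ x :* k) :+ (d :+ y :* k))
                            refl c x d y k
      where open +-*-Solver

    law : ∀ i (c d e : Fin k) x y z → carry (step′ i c d e) x y z ⇔ carry i (c ⊕₁ x) (d ⊕₁ y) (e ⊕₁ z)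
    law 0F c d e x y z = subst (λ s → carry (step′ 0F c d e) x y z ⇔ (s ≡ e ⊕₁ z))
      (regroup (toℕ c) x (toℕ d) y) (proj₂ (next₀ c d e) x y z)
    law 1F c d e x y z = subst (λ s → carry (step′ 1F c d e) x y z ⇔ (suc s ≡ e ⊕₁ z))
      (regroup (toℕ c) x (toℕ d) y) (proj₂ (next₁ c d e) x y z)
    law 2F c d e x y z = ⇔-id _

  -- A function enters formulas through its graph, with the value as first coordinate.
  record AutomaticFun {n} (f : Vec ℕ n → ℕ) : Set₁ where
    constructor fun
    field graph : Automatic (λ ρ → head ρ ≡ f (tail ρ))

  open AutomaticFun

  -- `R (f ρ ∷ ρ)` says that some `y` equals `f ρ` and satisfies `R (y ∷ ρ)`.
  substitute : ∀ {n} {f : Vec ℕ n → ℕ} {R : Vec ℕ (suc n) → Set} →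
               AutomaticFun f → Automatic R → Automatic (λ ρ → R (f ρ ∷ ρ))
  substitute F A = respᴬ (λ ρ → mk⇔ (λ { (_ , refl , r) → r }) (λ r → _ , refl , r)) (∃ᴬ graph F ∧ᴬ A)

  weaken : ∀ {n} {f : Vec ℕ n → ℕ} → AutomaticFun f → AutomaticFun (f ∘ tail)
  weaken {f = f} F = fun (preimage (λ ρ → head ρ ∷ tail (tail ρ))
    (λ { f (_ ∷ _ ∷ _) (_ ∷ _ ∷ _) → refl }) (λ _ → refl) (graph F))

  substitute₂ : ∀ {n} {f g : Vec ℕ n → ℕ} {R : Vec ℕ 2 → Set} →
                AutomaticFun f → AutomaticFun g → Automatic R → Automatic (λ ρ → R (f ρ ∷ g ρ ∷ []))
  -- The value of `g` ends up in front of that of `f`, hence the swap.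
  substitute₂ F G A = substitute F (substitute (weaken G) (select (1F ∷ 0F ∷ []) A))

  private
    sumAt : ∀ {n} (i j l : Fin n) → Automatic (λ ρ → lookup ρ i + lookup ρ j ≡ lookup ρ l)
    sumAt i j l = select (i ∷ j ∷ l ∷ []) (carry-automatic 0F)

    -- 0 is the only solution of `x + x = x`.
    zero-automatic : Automatic {1} (λ ρ → head ρ ≡ 0)
    zero-automatic = respᴬ (λ { (x ∷ []) → mk⇔ (λ eq → +-cancelˡ-≡ x x 0 (trans eq (sym (+-identityʳ x))))
                                               (λ { refl → refl }) })
                           (sumAt 0F 0F 0F)

  infix  10 #_

  #0 : ∀ {n} → AutomaticFun {n} (λ _ → 0)
  #0 = fun (respᴬ (λ { (_ ∷ _) → ⇔-id _ }) (select (0F ∷ []) zero-automatic))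

  #1 : ∀ {n} → AutomaticFun {n} (λ _ → 1)
  #1 = fun (respᴬ (λ { (_ ∷ _) → mk⇔ sym sym })
                  -- 1 is the result of `0 + 0` with an incoming carry.
                  (substitute #0 (select (0F ∷ 0F ∷ 1F ∷ []) (carry-automatic 1F))))

  #_ : ∀ {n} (i : Fin n) → AutomaticFun (λ ρ → lookup ρ i)
  -- The equation between head and coordinate is written as a sum with first summand 0.
  # i = fun (respᴬ (λ { (x ∷ ρ) → ⇔-id _ }) (substitute #0 (sumAt 0F 1F (Fin.suc (Fin.suc i)))))

  infixl 6 _+ᴬ_
  infixr 7 _*ᴬ_
  infix  4 _≡ᴬ_ _≤ᴬ_ _<ᴬ_

  _+ᴬ_ : ∀ {n} {f g : Vec ℕ n → ℕ} → AutomaticFun f → AutomaticFun g → AutomaticFun (λ ρ → f ρ + g ρ)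
  F +ᴬ G = fun (respᴬ (λ { (_ ∷ _) → mk⇔ sym sym })
                      (substitute (weaken G) (substitute (weaken (weaken F)) (sumAt 0F 1F 2F))))

  -- The multiplier is a constant, so the product is an iterated sum.
  _*ᴬ_ : ∀ {n} (c : ℕ) {f : Vec ℕ n → ℕ} → AutomaticFun f → AutomaticFun (λ ρ → c * f ρ)
  zero  *ᴬ F = #0
  suc c *ᴬ F = F +ᴬ (c *ᴬ F)

  _≡ᴬ_ : ∀ {n} {f g : Vec ℕ n → ℕ} → AutomaticFun f → AutomaticFun g → Automatic (λ ρ → f ρ ≡ g ρ)
  F ≡ᴬ G = substitute F (graph G)

  _≤ᴬ_ : ∀ {n} {f g : Vec ℕ n → ℕ} → AutomaticFun f → AutomaticFun g → Automatic (λ ρ → f ρ ≤ g ρ)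
  F ≤ᴬ G = respᴬ (λ ρ → mk⇔ (λ (z , eq) → subst (_ ≤_) eq (m≤m+n _ z)) (λ le → _ , m+[n∸m]≡n le))
                 (∃ᴬ weaken F +ᴬ # 0F ≡ᴬ weaken G)

  _<ᴬ_ : ∀ {n} {f g : Vec ℕ n → ℕ} → AutomaticFun f → AutomaticFun g → Automatic (λ ρ → f ρ < g ρ)
  F <ᴬ G = #1 +ᴬ F ≤ᴬ G

  predᴬ : ∀ {n} {f : Vec ℕ n → ℕ} → AutomaticFun f → AutomaticFun (λ ρ → f ρ ∸ 1)
  predᴬ {f = f} F = fun (respᴬ (λ { (y ∷ ρ) → pred⇔ y (f ρ) })
    (weaken F ≡ᴬ #0 ∧ᴬ # 0F ≡ᴬ #0 ∨ᴬ weaken F ≡ᴬ #1 +ᴬ # 0F))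
    where
    pred⇔ : ∀ y x → (x ≡ 0 × y ≡ 0 ⊎ x ≡ suc y) ⇔ (y ≡ x ∸ 1)
    pred⇔ y zero    = mk⇔ (λ { (inj₁ (_ , eq)) → eq ; (inj₂ ()) }) (λ eq → inj₁ (refl , eq))
    pred⇔ y (suc x) = mk⇔ (λ { (inj₂ refl) → refl }) (λ { refl → inj₂ refl })

-- Letters of the automatic sequence

module Sequence (b d : ℕ) (M : DFAO (suc (suc b)) d) (a : ℕ → Fin d) (gen : Generates M a) where

  open Automata b
  open Arithmetic b
  open DFAO M

  infixr 6 _▹_

  -- The number whose lowest digits are `w`, least significant first, with `x` above them.
  _▹_ : List (Fin k) → ℕ → ℕ
  w ▹ x = foldr _⊕₁_ x w

  run : List (Fin k) → Fin nQ
  run = foldl δ q₀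

  generates-reversed : ∀ w → a (w ▹ 0) ≡ τ (run w)
  generates-reversed w = trans (gen (w ▹ 0) (reverse w) value) (cong (τ ∘ run) (List.reverse-involutive w))
    where
    value : val (reverse w) ≡ w ▹ 0
    value = trans (List.reverse-foldl _ 0 w) (flip-⊕ w)
      where
      flip-⊕ : ∀ w → foldr (λ c acc → acc * k + toℕ c) 0 w ≡ w ▹ 0
      flip-⊕ []      = refl
      flip-⊕ (c ∷ w) = trans (cong (λ n → n * k + toℕ c) (flip-⊕ w)) (+-comm _ (toℕ c))

  digits : ∀ x → ∃[ w ] w ▹ 0 ≡ x
  digits = digit-induction₁ _ ([] , refl) λ { c x (w , refl) → c ∷ w , refl }

  -- The digits `v` of `x` are read from the state `run w`, so the sequence `a (w ▹ x)` in `x`, a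
  -- member of the k-kernel of `a`, depends on that state alone.
  run-determines : ∀ w w′ → run w ≡ run w′ → ∀ x → a (w ▹ x) ≡ a (w′ ▹ x)
  run-determines w w′ eq x with v , refl ← digits x =
    trans (value w) (trans (cong (λ q → τ (foldl δ q v)) eq) (sym (value w′)))
    where
    value : ∀ w → a (w ▹ v ▹ 0) ≡ τ (foldl δ (run w) v)
    value w = trans (cong a (sym (List.foldr-++ _⊕₁_ 0 w v)))
      (trans (generates-reversed (w ++ v)) (cong τ (List.foldl-++ δ q₀ w v)))

  -- Only the reachable states generate sequences: the output at an unreachable state may
  -- change with leading zeros.  Hence L is empty there and step′ never leaves such a state.
  letter-automatic : ∀ e → Automatic {1} (λ ρ → a (head ρ) ≡ e)
  letter-automatic e = record
    { size = nQ ; init = q₀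
    ; step = λ { q (c ∷ []) → step′ q c }
    ; Lang = λ { q (x ∷ []) → L q x }
    ; Lang-init = λ { (x ∷ []) → mk⇔ (λ (w , eq , l) → trans (run-determines [] w (sym eq) x) l) (λ l → [] , refl , l) }
    ; Lang-step = λ { q (c ∷ []) (x ∷ []) → law q c x }
    ; Lang-0? = zero? }
    where
    L : Fin nQ → ℕ → Set
    L q x = ∃[ w ] (run w ≡ q × a (w ▹ x) ≡ e)

    reached? : ∀ q → Dec (∃[ w ] run w ≡ q)
    reached? q = reachable? δ (Fin._≟ q) q₀

    step′ : Fin nQ → Fin k → Fin nQ
    step′ q c with reached? q
    ... | yes _ = δ q c
    ... | no _  = q

    law : ∀ q c x → L (step′ q c) x ⇔ L q (c ⊕₁ x)
    law q c x with reached? q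
    ... | no ¬reached = mk⇔ (λ (w , eq , _) → contradiction (w , eq) ¬reached)
                            (λ (w , eq , _) → contradiction (w , eq) ¬reached)
    ... | yes (w , refl) = mk⇔
      (λ (w′ , eq , l) → w , refl ,
        trans (sym (▹-snoc w)) (trans (run-determines (w ++ c ∷ []) w′ (trans (run-snoc w) (sym eq)) x) l))
      (λ (w′ , eq , l) → w′ ++ c ∷ [] , trans (run-snoc w′) (cong (λ q → δ q c) eq) , trans (▹-snoc w′) l)
      where
      run-snoc : ∀ w → run (w ++ c ∷ []) ≡ δ (run w) c
      run-snoc w = List.foldl-++ δ q₀ w _
      ▹-snoc : ∀ w → a ((w ++ c ∷ []) ▹ x) ≡ a (w ▹ c ⊕₁ x)
      ▹-snoc w = cong a (List.foldr-++ _⊕₁_ x w _)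

    zero? : ∀ q → Dec (L q 0)
    zero? q with reached? q
    ... | no ¬reached = no λ (w , eq , _) → ¬reached (w , eq)
    ... | yes (w , eq) = Dec.map′ (λ l → w , eq , l)
      (λ (w′ , eq′ , l) → trans (run-determines w w′ (trans eq (sym eq′)) 0) l) (a (w ▹ 0) Fin.≟ e)

  -- The alphabet is finite, so a relation between two letters is a finite disjunction over their
  -- values.
  letters : ∀ {n} {f g : Vec ℕ n → ℕ} {R : Fin d → Fin d → Set} → (∀ e e′ → Dec (R e e′)) →
            AutomaticFun f → AutomaticFun g → Automatic (λ ρ → R (a (f ρ)) (a (g ρ)))
  letters {R = R} R? F G = respᴬ (λ ρ → mk⇔ (λ { (_ , _ , refl , refl , r) → r }) (λ r → _ , _ , refl , refl , r))
    (⋁ᴬ λ e → ⋁ᴬ λ e′ → substitute F (letter e) ∧ᴬ substitute G (letter e′) ∧ᴬ constᴬ (R? e e′))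
    where
    letter : ∀ {n} e → Automatic {suc n} (λ ρ → a (lookup ρ 0F) ≡ e)
    letter e = select (0F ∷ []) (letter-automatic e)

-- Words and factors

module _ {A : Set} where

  nth : List A → ℕ → Maybe A
  nth []       _       = nothing
  nth (x ∷ xs) zero    = just x
  nth (x ∷ xs) (suc j) = nth xs j

  nth-++ˡ : ∀ (xs ys : List A) {j} → j < length xs → nth (xs ++ ys) j ≡ nth xs j
  nth-++ˡ (x ∷ xs) ys {zero}  _        = refl
  nth-++ˡ (x ∷ xs) ys {suc j} (s≤s lt) = nth-++ˡ xs ys lt

  nth-++ʳ : ∀ (xs ys : List A) j → nth (xs ++ ys) (length xs + j) ≡ nth ys j
  nth-++ʳ []       ys j = refl
  nth-++ʳ (x ∷ xs) ys j = nth-++ʳ xs ys j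

  nth-take : ∀ L (xs : List A) {j} → j < L → nth (take L xs) j ≡ nth xs j
  nth-take (suc L) []       _                = refl
  nth-take (suc L) (x ∷ xs) {zero}  _        = refl
  nth-take (suc L) (x ∷ xs) {suc j} (s≤s lt) = nth-take L xs lt

  -- Mirror positions are tied by `j + suc j′` being the length, which avoids subtraction and
  -- carries over to automatic formulas.
  nth-reverse : ∀ (xs : List A) j j′ → j + suc j′ ≡ length xs → nth (reverse xs) j ≡ nth xs j′
  nth-reverse []       j j′ eq = contradiction (trans (sym (+-suc j j′)) eq) λ ()
  nth-reverse (x ∷ xs) j zero eq = begin
    nth (reverse (x ∷ xs)) j                               ≡⟨ cong (λ ys → nth ys j) (List.unfold-reverse x xs) ⟩
    nth (reverse xs ++ x ∷ []) j                           ≡⟨ cong (nth (reverse xs ++ x ∷ [])) j≡ ⟩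
    nth (reverse xs ++ x ∷ []) (length (reverse xs) + 0)   ≡⟨ nth-++ʳ (reverse xs) (x ∷ []) 0 ⟩
    just x                                                 ∎
    where
    open ≡-Reasoning
    j≡ : j ≡ length (reverse xs) + 0
    j≡ = trans (ℕ.suc-injective (trans (+-comm 1 j) eq)) (sym (trans (+-identityʳ _) (List.length-reverse xs)))
  nth-reverse (x ∷ xs) j (suc j′) eq = begin
    nth (reverse (x ∷ xs)) j      ≡⟨ cong (λ ys → nth ys j) (List.unfold-reverse x xs) ⟩
    nth (reverse xs ++ x ∷ []) j  ≡⟨ nth-++ˡ (reverse xs) (x ∷ []) j< ⟩
    nth (reverse xs) j            ≡⟨ nth-reverse xs j j′ eq′ ⟩
    nth xs j′                     ∎
    where
    open ≡-Reasoning
    eq′ : j + suc j′ ≡ length xs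
    eq′ = ℕ.suc-injective (trans (sym (+-suc j (suc j′))) eq)
    j< : j < length (reverse xs)
    j< = subst (j <_) (trans eq′ (sym (List.length-reverse xs))) (m<m+n j (s≤s z≤n))

  nth-applyUpTo : ∀ (f : ℕ → A) L {j} → j < L → nth (applyUpTo f L) j ≡ just (f j)
  nth-applyUpTo f (suc L) {zero}  _        = refl
  nth-applyUpTo f (suc L) {suc j} (s≤s lt) = nth-applyUpTo (f ∘ suc) L lt

  ≡-applyUpTo : ∀ (f : ℕ → A) L xs → length xs ≡ L → (∀ {j} → j < L → nth xs j ≡ just (f j)) → xs ≡ applyUpTo f L
  ≡-applyUpTo f zero    []       _  _ = refl
  ≡-applyUpTo f (suc L) (x ∷ xs) eq h =
    cong₂ _∷_ (just-injective (h (s≤s z≤n))) (≡-applyUpTo (f ∘ suc) L xs (ℕ.suc-injective eq) (h ∘ s≤s))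

  applyUpTo-++⇔ : ∀ (f : ℕ → A) m xs ys → m ≡ length xs →
                  xs ++ ys ≡ applyUpTo f (m + length ys) ⇔
                  (xs ≡ applyUpTo f m × ys ≡ applyUpTo (λ j → f (m + j)) (length ys))
  applyUpTo-++⇔ f _ []       ys refl = mk⇔ (λ eq → refl , eq) proj₂
  applyUpTo-++⇔ f _ (x ∷ xs) ys refl =
    mk⇔ (λ eq → let p , q = to ih (List.∷-injectiveʳ eq) in cong₂ _∷_ (List.∷-injectiveˡ eq) p , q)
        (λ (p , q) → cong₂ _∷_ (List.∷-injectiveˡ p) (from ih (List.∷-injectiveʳ p , q)))
    where ih = applyUpTo-++⇔ (f ∘ suc) _ xs ys refl

  length-power : ∀ n (x : List A) → length (concat (List.replicate n x)) ≡ n * length x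
  length-power zero    x = refl
  length-power (suc n) x = trans (List.length-++ x) (cong (length x +_) (length-power n x))

  -- The extra copy of `x` may be put at the end, where it leaves earlier positions alone. Against
  -- the shift caused by a copy in front, this yields periodicity.
  nth-∷ʳ-power : ∀ n (x : List A) {j} → j < n * length x →
                 nth (concat (List.replicate (suc n) x)) j ≡ nth (concat (List.replicate n x)) j
  nth-∷ʳ-power n x {j} j< = trans (cong (λ ys → nth ys j) (sym (snoc n)))
    (nth-++ˡ (concat (List.replicate n x)) x (subst (j <_) (sym (length-power n x)) j<))
    where
    snoc : ∀ n → concat (List.replicate n x) ++ x ≡ concat (List.replicate (suc n) x)
    snoc zero    = sym (List.++-identityʳ x)
    snoc (suc n) = trans (List.++-assoc x _ x) (cong (x ++_) (snoc n))

  applyUpTo-cong⇔ : ∀ (f g : ℕ → A) L → applyUpTo f L ≡ applyUpTo g L ⇔ (∀ j → j < L → f j ≡ g j)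
  applyUpTo-cong⇔ f g L = mk⇔
    (λ eq j j< → just-injective (trans (sym (nth-applyUpTo f L j<))
      (trans (cong (λ xs → nth xs j) eq) (nth-applyUpTo g L j<))))
    (λ h → ≡-applyUpTo g L _ (List.length-applyUpTo f L) (λ j< → trans (nth-applyUpTo f L j<) (cong just (h _ j<))))

  reverse-applyUpTo⇔ : ∀ (f g : ℕ → A) L →
                       reverse (applyUpTo f L) ≡ applyUpTo g L ⇔ (∀ j j′ → j + suc j′ ≡ L → g j ≡ f j′)
  reverse-applyUpTo⇔ f g L = mk⇔
    (λ { eq j j′ refl → just-injective (begin
      just (g j)                          ≡⟨ nth-applyUpTo g L (m<m+n j (s≤s z≤n)) ⟨
      nth (applyUpTo g L) j               ≡⟨ cong (λ xs → nth xs j) eq ⟨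
      nth (reverse (applyUpTo f L)) j     ≡⟨ nth-rev j j′ refl ⟩
      just (f j′)                         ∎) })
    (λ h → ≡-applyUpTo g L _ (trans (List.length-reverse (applyUpTo f L)) (List.length-applyUpTo f L))
      (λ {j} j< → let j′ = L ∸ suc j ; eq = trans (+-suc j j′) (m+[n∸m]≡n j<) in
        trans (nth-rev j j′ eq) (cong just (sym (h j j′ eq)))))
    where
    open ≡-Reasoning
    nth-rev : ∀ j j′ → j + suc j′ ≡ L → nth (reverse (applyUpTo f L)) j ≡ just (f j′)
    nth-rev j j′ refl = trans (nth-reverse (applyUpTo f L) j j′ (sym (List.length-applyUpTo f L)))
                              (nth-applyUpTo f L (m≤n+m (suc j′) j))

  Periodic : (ℕ → A) → ℕ → ℕ → Set
  Periodic f p L = ∀ j → j + p < L → f j ≡ f (j + p)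

  -- A prefix of `x^ω` that contains all of `x` is determined by its first `|x|` letters and the
  -- period `|x|`.
  ωPrefix⇔ : ∀ (f : ℕ → A) L x → 1 ≤ length x → length x ≤ L →
             applyUpTo f L ≡ ωPrefix x L ⇔ (x ≡ applyUpTo f (length x) × Periodic f (length x) L)
  ωPrefix⇔ f zero    x 1≤p p≤L = contradiction (≤-trans 1≤p p≤L) λ ()
  ωPrefix⇔ f (suc L) x 1≤p p≤L = mk⇔ (λ eq → prefix eq , periodic eq) (λ (eq , h) → sym (unroll eq h))
    where
    p = length x
    power : ℕ → List A
    power n = concat (List.replicate n x)

    nth-power : applyUpTo f (suc L) ≡ ωPrefix x (suc L) → ∀ {j} → j < suc L → nth (power (suc L)) j ≡ just (f j)
    nth-power eq {j} j< = begin
      nth (power (suc L)) j        ≡⟨ nth-take (suc L) (power (suc L)) j< ⟨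
      nth (ωPrefix x (suc L)) j    ≡⟨ cong (λ xs → nth xs j) eq ⟨
      nth (applyUpTo f (suc L)) j  ≡⟨ nth-applyUpTo f (suc L) j< ⟩
      just (f j)                   ∎
      where open ≡-Reasoning

    prefix : applyUpTo f (suc L) ≡ ωPrefix x (suc L) → x ≡ applyUpTo f p
    prefix eq = ≡-applyUpTo f p x refl λ j< →
      trans (sym (nth-++ˡ x (power L) j<)) (nth-power eq (≤-trans j< p≤L))

    periodic : applyUpTo f (suc L) ≡ ωPrefix x (suc L) → Periodic f p (suc L)
    periodic eq j j+p< = just-injective (begin
      just (f j)                   ≡⟨ nth-power eq (≤-trans (s≤s (m≤m+n j p)) j+p<) ⟨
      nth (power (suc L)) j        ≡⟨ nth-∷ʳ-power L x j<Lp ⟩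
      nth (power L) j              ≡⟨ nth-++ʳ x (power L) j ⟨
      nth (power (suc L)) (p + j)  ≡⟨ cong (nth (power (suc L))) (+-comm p j) ⟩
      nth (power (suc L)) (j + p)  ≡⟨ nth-power eq j+p< ⟩
      just (f (j + p))             ∎)
      where
      open ≡-Reasoning
      j<Lp : j < L * p
      j<Lp = ≤-trans (≤-trans (subst (_≤ j + p) (+-comm j 1) (+-monoʳ-≤ j 1≤p)) (s≤s⁻¹ j+p<))
                     (m≤m*n L p {{ℕ.>-nonZero 1≤p}})

    unroll : x ≡ applyUpTo f p → Periodic f p (suc L) → ωPrefix x (suc L) ≡ applyUpTo f (suc L)
    unroll eq h = ≡-applyUpTo f (suc L) _ length-ωPrefix
      (λ {j} j< → trans (nth-take (suc L) (power (suc L)) j<)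
        (agree (suc L) j j< (≤-trans j< (m≤m*n (suc L) p {{ℕ.>-nonZero 1≤p}}))))
      where
      length-ωPrefix : length (ωPrefix x (suc L)) ≡ suc L
      length-ωPrefix = trans (List.length-take (suc L) (power (suc L))) (m≤n⇒m⊓n≡m
        (subst (suc L ≤_) (sym (length-power (suc L) x)) (m≤m*n (suc L) p {{ℕ.>-nonZero 1≤p}})))

      -- Induction on the number of copies: beyond the first copy, position `p + i` moves back to
      -- `i`, in the power by removing a copy and in `f` by the period.
      agree : ∀ n j → j < suc L → j < n * p → nth (power n) j ≡ just (f j)
      agree (suc n) j j<L j<np with j ℕ.<? p
      ... | yes j<p = trans (nth-++ˡ x (power n) j<p)
                            (trans (cong (λ xs → nth xs j) eq) (nth-applyUpTo f p j<p))
      ... | no j≮p with i , refl ← m≤n⇒∃[o]m+o≡n (≮⇒≥ j≮p) = begin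
        nth (power (suc n)) (p + i)  ≡⟨ nth-++ʳ x (power n) i ⟩
        nth (power n) i              ≡⟨ agree n i (≤-trans (s≤s (m≤n+m i p)) j<L) (+-cancelˡ-< p i (n * p) j<np) ⟩
        just (f i)                   ≡⟨ cong just (h i (subst (_< suc L) (+-comm p i) j<L)) ⟩
        just (f (i + p))             ≡⟨ cong (just ∘ f) (+-comm i p) ⟩
        just (f (p + i))             ∎
        where open ≡-Reasoning

  ≢[]⇒nonempty : ∀ {x : List A} → x ≢ [] → 1 ≤ length x
  ≢[]⇒nonempty {[]}    x≢[] = contradiction refl x≢[]
  ≢[]⇒nonempty {_ ∷ _} _    = s≤s z≤n

  nonempty⇒≢[] : ∀ {x : List A} → 1 ≤ length x → x ≢ []
  nonempty⇒≢[] () refl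

  length-factorAt : ∀ (a : ℕ → A) i L → length (factorAt a i L) ≡ L
  length-factorAt a i L = trans (List.length-map _ (upTo L)) (List.length-upTo L)

  factorAt-isFactor : ∀ (a : ℕ → A) i L → IsFactor a (factorAt a i L)
  factorAt-isFactor a i L = i , cong (factorAt a i) (sym (length-factorAt a i L))

  Contains⇔ : ∀ (a : ℕ → A) {P : List A → Set} → Contains a P ⇔ (∃₂ λ i L → P (factorAt a i L))
  Contains⇔ a {P} = mk⇔ (λ (w , (i , eq) , h) → i , length w , subst P eq h)
                    (λ (i , L , h) → factorAt a i L , factorAt-isFactor a i L , h)

  -- The length condition is a parameter `B`, so that both kinds of powers in the statement are
  -- instances by unfolding.
  PowerOf : (ℕ → ℕ → Set) → List A → List A → Set
  PowerOf B x z = x ≢ [] × z ≡ ωPrefix x (length z) × B (length x) (length z)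

  -- Only the length `p` of the period word is kept, since the factor itself supplies the word; all
  -- quantifiers then range over numbers.
  HasPowerAt : (ℕ → ℕ → Set) → (ℕ → A) → ℕ → ℕ → ℕ → Set
  HasPowerAt B a l i L = ∃[ p ] (1 ≤ p × l ≤ p × B p L × Periodic (λ j → a (i + j)) p L)

  PowerOf⇔HasPowerAt : ∀ {B : ℕ → ℕ → Set} → (∀ p L → B p L → p ≤ L) → ∀ a l i L →
    (∃[ x ] (l ≤ length x × PowerOf B x (factorAt a i L))) ⇔ HasPowerAt B a l i L
  PowerOf⇔HasPowerAt {B} B⇒≤ a l i L
    rewrite length-factorAt a i L | List.map-upTo (λ j → a (i + j)) L = mk⇔
      (λ { (x , l≤ , x≢[] , eq , B-x) → length x , ≢[]⇒nonempty x≢[] , l≤ , B-x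
                                      , proj₂ (to (ωPrefix⇔ f L x (≢[]⇒nonempty x≢[]) (B⇒≤ _ _ B-x)) eq) })
      (λ (p , 1≤p , l≤p , B-p , h) → build (applyUpTo f p) refl (List.length-applyUpTo f p) 1≤p l≤p B-p h)
    where
    f : ℕ → A
    f j = a (i + j)
    build : ∀ {p} x → x ≡ applyUpTo f p → length x ≡ p → 1 ≤ p → l ≤ p → B p L → Periodic f p L →
            ∃[ x ] (l ≤ length x × x ≢ [] × applyUpTo f L ≡ ωPrefix x L × B (length x) L)
    build x eq refl 1≤p l≤p B-p h =
      x , l≤p , nonempty⇒≢[] 1≤p , from (ωPrefix⇔ f L x 1≤p (B⇒≤ _ _ B-p)) (eq , h) , B-p

  applyUpTo-map-square⇔ : ∀ (f : ℕ → A) (g : A → A) L →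
    (∃[ x ] (x ≢ [] × applyUpTo f L ≡ x ++ List.map g x)) ⇔
    (∃[ p ] (1 ≤ p × p + p ≡ L × (∀ j → j < p → g (f j) ≡ f (p + j))))
  applyUpTo-map-square⇔ f g L = mk⇔ forth back
    where
    open ≡-Reasoning
    forth : (∃[ x ] (x ≢ [] × applyUpTo f L ≡ x ++ List.map g x)) → _
    forth (x , x≢[] , eq) = p , ≢[]⇒nonempty x≢[] , p+p≡L ,
      to (applyUpTo-cong⇔ (g ∘ f) (f ∘ (p +_)) p) (begin
        applyUpTo (g ∘ f) p                       ≡⟨ List.map-applyUpTo f g p ⟨
        List.map g (applyUpTo f p)                ≡⟨ cong (List.map g) (proj₁ halves) ⟨
        List.map g x                              ≡⟨ proj₂ halves ⟩
        applyUpTo (f ∘ (p +_)) (length (List.map g x)) ≡⟨ cong (applyUpTo _) (List.length-map g x) ⟩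
        applyUpTo (f ∘ (p +_)) p                  ∎)
      where
      p = length x
      p+p≡L : p + p ≡ L
      p+p≡L = begin
        p + p                              ≡⟨ cong (p +_) (List.length-map g x) ⟨
        p + length (List.map g x)          ≡⟨ List.length-++ x ⟨
        length (x ++ List.map g x)         ≡⟨ cong length eq ⟨
        length (applyUpTo f L)             ≡⟨ List.length-applyUpTo f L ⟩
        L                                  ∎
      halves = to (applyUpTo-++⇔ f p x (List.map g x) refl) (begin
        x ++ List.map g x                          ≡⟨ eq ⟨
        applyUpTo f L                              ≡⟨ cong (applyUpTo f) p+p≡L ⟨
        applyUpTo f (p + p)                        ≡⟨ cong (λ n → applyUpTo f (p + n)) (List.length-map g x) ⟨
        applyUpTo f (p + length (List.map g x))    ∎)
    back : (∃[ p ] (1 ≤ p × p + p ≡ L × (∀ j → j < p → g (f j) ≡ f (p + j)))) → _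
    back (p , 1≤p , refl , h) = x , nonempty⇒≢[] (subst (1 ≤_) (sym ∣x∣≡p) 1≤p) , sym (begin
      x ++ List.map g x                        ≡⟨ from (applyUpTo-++⇔ f p x (List.map g x) (sym ∣x∣≡p)) (refl , second) ⟩
      applyUpTo f (p + length (List.map g x))  ≡⟨ cong (λ n → applyUpTo f (p + n)) ∣gx∣≡p ⟩
      applyUpTo f (p + p)                      ∎)
      where
      x = applyUpTo f p
      ∣x∣≡p : length x ≡ p
      ∣x∣≡p = List.length-applyUpTo f p
      ∣gx∣≡p : length (List.map g x) ≡ p
      ∣gx∣≡p = trans (List.length-map g x) ∣x∣≡p
      second : List.map g x ≡ applyUpTo (f ∘ (p +_)) (length (List.map g x))
      second = begin
        List.map g x                                   ≡⟨ List.map-applyUpTo f g p ⟩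
        applyUpTo (g ∘ f) p                            ≡⟨ from (applyUpTo-cong⇔ (g ∘ f) (f ∘ (p +_)) p) h ⟩
        applyUpTo (f ∘ (p +_)) p                       ≡⟨ cong (applyUpTo _) ∣gx∣≡p ⟨
        applyUpTo (f ∘ (p +_)) (length (List.map g x)) ∎

-- Infinite sets as unbounded sets

module _ {X : Set} (size : X → ℕ) (below : ℕ → List X) (∈-below : ∀ N x → size x < N → x ∈ below N) where

  -- Finitely many elements have size below `N`, so an infinite set goes past `N`; conversely, an
  -- element larger than all members of a list is not in it.
  Infinite⇔unbounded : ∀ {P : X → Set} → Infinite P ⇔ (∀ N → ∃[ x ] (N ≤ size x × P x))
  Infinite⇔unbounded {P} = mk⇔ forth back
    where
    forth : Infinite P → ∀ N → ∃[ x ] (N ≤ size x × P x)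
    forth inf N with x , h , x∉ ← inf (below N) = x , ≮⇒≥ (x∉ ∘ ∈-below N x) , h
    back : (∀ N → ∃[ x ] (N ≤ size x × P x)) → Infinite P
    back unb l with x , large , h ← unb (suc (max 0 (List.map size l))) =
      x , h , λ x∈l → <⇒≱ large (ListAll.lookup (xs≤max 0 (List.map size l)) (∈-map⁺ size x∈l))

∈-pairs : ∀ N (p : ℕ × ℕ) → uncurry _+_ p < N → p ∈ cartesianProduct (upTo N) (upTo N)
∈-pairs N (i , L) lt = ∈-cartesianProduct⁺ (∈-upTo⁺ (≤-trans (s≤s (m≤m+n i L)) lt))
                                          (∈-upTo⁺ (≤-trans (s≤s (m≤n+m L i)) lt))

words : ∀ d → ℕ → List (List (Fin d))
words d zero    = []
words d (suc N) = [] ∷ cartesianProductWith _∷_ (allFin d) (words d N)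

∈-words : ∀ {d} N (w : List (Fin d)) → length w < N → w ∈ words d N
∈-words (suc N) []      _        = here refl
∈-words (suc N) (c ∷ w) (s≤s lt) = there (∈-cartesianProductWith⁺ _∷_ (∈-allFin c) (∈-words N w lt))

-- Exponents

-- Unreduced fractions keep numerators and denominators explicit, which normalisation of a product
-- would hide.
_represents_/suc_ : ℚ → ℕ → ℕ → Set
x represents m /suc n = toℚᵘ x ℚᵘ.≃ mkℚᵘ (ℤ.+ m) n

natural-represents : ∀ m → (ℤ.+ m ℚ./ 1) represents m /suc 0
natural-represents m = ℚ.toℚᵘ-fromℚᵘ (mkℚᵘ (ℤ.+ m) 0)

multiple-represents : ∀ n m .(c : Coprime n (suc m)) p →
                      (mkℚ (ℤ.+ n) m c ℚ.* (ℤ.+ p ℚ./ 1)) represents (n * p) /suc m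
multiple-represents n m c p =
  ℚᵘ.≃-trans (ℚ.toℚᵘ-homo-* (mkℚ (ℤ.+ n) m c) (ℤ.+ p ℚ./ 1))
  (ℚᵘ.≃-trans (ℚᵘ.*-congˡ {mkℚᵘ (ℤ.+ n) m} (natural-represents p))
    (*≡* (cong₂ ℤ._*_ (sym (ℤ.pos-* n p)) (cong ℤ.+_ (sym (*-identityʳ (suc m)))))))

module _ {x y m n m′ n′} (x-rep : x represents m /suc n) (y-rep : y represents m′ /suc n′) where

  -- Clearing denominators leaves an inequality of naturals whose coefficients are constants, as
  -- addition can express.
  ≤⇔cross : x ℚ.≤ y ⇔ suc n′ * m ≤ suc n * m′
  ≤⇔cross = mk⇔
    (λ x≤y → cross (ℚᵘ.drop-*≤* (ℚᵘ.≤-respˡ-≃ x-rep (ℚᵘ.≤-respʳ-≃ y-rep (ℚ.toℚᵘ-mono-≤ x≤y)))))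
    (λ le → ℚ.toℚᵘ-cancel-≤ (ℚᵘ.≤-respˡ-≃ (ℚᵘ.≃-sym x-rep) (ℚᵘ.≤-respʳ-≃ (ℚᵘ.≃-sym y-rep) (*≤* (uncross le)))))
    where
    cross : ℤ.+ m ℤ.* ℤ.+ suc n′ ℤ.≤ ℤ.+ m′ ℤ.* ℤ.+ suc n → suc n′ * m ≤ suc n * m′
    cross le rewrite sym (ℤ.pos-* m (suc n′)) | sym (ℤ.pos-* m′ (suc n)) =
      subst₂ _≤_ (*-comm m _) (*-comm m′ _) (ℤ.drop‿+≤+ le)
    uncross : suc n′ * m ≤ suc n * m′ → ℤ.+ m ℤ.* ℤ.+ suc n′ ℤ.≤ ℤ.+ m′ ℤ.* ℤ.+ suc n
    uncross le rewrite sym (ℤ.pos-* m (suc n′)) | sym (ℤ.pos-* m′ (suc n)) =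
      ℤ.+≤+ (subst₂ _≤_ (*-comm _ m) (*-comm _ m′) le)

  <⇔cross : x ℚ.< y ⇔ suc n′ * m < suc n * m′
  <⇔cross = mk⇔
    (λ x<y → cross (ℚᵘ.drop-*<* (ℚᵘ.<-respˡ-≃ x-rep (ℚᵘ.<-respʳ-≃ y-rep (ℚ.toℚᵘ-mono-< x<y)))))
    (λ lt → ℚ.toℚᵘ-cancel-< (ℚᵘ.<-respˡ-≃ (ℚᵘ.≃-sym x-rep) (ℚᵘ.<-respʳ-≃ (ℚᵘ.≃-sym y-rep) (*<* (uncross lt)))))
    where
    cross : ℤ.+ m ℤ.* ℤ.+ suc n′ ℤ.< ℤ.+ m′ ℤ.* ℤ.+ suc n → suc n′ * m < suc n * m′
    cross lt rewrite sym (ℤ.pos-* m (suc n′)) | sym (ℤ.pos-* m′ (suc n)) =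
      subst₂ _<_ (*-comm m _) (*-comm m′ _) (ℤ.drop‿+<+ lt)
    uncross : suc n′ * m < suc n * m′ → ℤ.+ m ℤ.* ℤ.+ suc n′ ℤ.< ℤ.+ m′ ℤ.* ℤ.+ suc n
    uncross lt rewrite sym (ℤ.pos-* m (suc n′)) | sym (ℤ.pos-* m′ (suc n)) =
      ℤ.+<+ (subst₂ _<_ (*-comm _ m) (*-comm _ m′) lt)

PowerLength PowerPlusLength : ℚ → ℕ → ℕ → Set
PowerLength r p L     = (r ℚ.* (ℤ.+ p ℚ./ 1)) ℚ.≤ (ℤ.+ L ℚ./ 1) × (ℤ.+ (L ∸ 1) ℚ./ 1) ℚ.< (r ℚ.* (ℤ.+ p ℚ./ 1))
PowerPlusLength r p L = (r ℚ.* (ℤ.+ p ℚ./ 1)) ℚ.< (ℤ.+ L ℚ./ 1) × (ℤ.+ (L ∸ 1) ℚ./ 1) ℚ.≤ (r ℚ.* (ℤ.+ p ℚ./ 1))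

-- From `r > 1` follows `p ≤ r p ≤ L`; hence a power contains its whole period word.
multiple-≤⇒≤ : ∀ {r} → 1ℚ ℚ.< r → ∀ {p L} → (r ℚ.* (ℤ.+ p ℚ./ 1)) ℚ.≤ (ℤ.+ L ℚ./ 1) → p ≤ L
multiple-≤⇒≤ {r} 1<r {p} {L} le = cancel (ℚ.≤-trans p≤rp le)
  where
  p≤rp : (ℤ.+ p ℚ./ 1) ℚ.≤ (r ℚ.* (ℤ.+ p ℚ./ 1))
  p≤rp = subst (ℚ._≤ (r ℚ.* (ℤ.+ p ℚ./ 1))) (ℚ.*-identityˡ (ℤ.+ p ℚ./ 1))
    (ℚ.*-monoʳ-≤-nonNeg (ℤ.+ p ℚ./ 1) {{ℚ.normalize-nonNeg p 1}} (ℚ.<⇒≤ 1<r))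
  cancel : (ℤ.+ p ℚ./ 1) ℚ.≤ (ℤ.+ L ℚ./ 1) → p ≤ L
  cancel le = subst₂ _≤_ (*-identityˡ p) (*-identityˡ L) (to (≤⇔cross (natural-represents p) (natural-represents L)) le)

module Bounds (b : ℕ) where

  open Automata b
  open Arithmetic b

  PowerLength-automatic : ∀ r → 1ℚ ℚ.< r → Automatic (λ ρ → PowerLength r (lookup ρ 0F) (lookup {n = 2} ρ 1F))
  -- A negative numerator contradicts `1 < r`.
  PowerLength-automatic (mkℚ -[1+ _ ] _ _) (ℚ.*<* ())
  PowerLength-automatic (mkℚ (ℤ.+ n) m c) _ = respᴬ
    (λ ρ → let rp = multiple-represents n m c (lookup ρ 0F) in
      ⇔-sym (≤⇔cross rp (natural-represents (lookup ρ 1F)) ×-⇔ <⇔cross (natural-represents (lookup ρ 1F ∸ 1)) rp))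
    -- With `r = n / suc m`, the outer factors are the denominators: 1 from the length and `suc m`
    -- from the multiple of `r`.
    (1 *ᴬ n *ᴬ # 0F ≤ᴬ suc m *ᴬ # 1F ∧ᴬ suc m *ᴬ predᴬ (# 1F) <ᴬ 1 *ᴬ n *ᴬ # 0F)

  PowerPlusLength-automatic : ∀ r → 1ℚ ℚ.< r → Automatic (λ ρ → PowerPlusLength r (lookup ρ 0F) (lookup {n = 2} ρ 1F))
  PowerPlusLength-automatic (mkℚ -[1+ _ ] _ _) (ℚ.*<* ())
  PowerPlusLength-automatic (mkℚ (ℤ.+ n) m c) _ = respᴬ
    (λ ρ → let rp = multiple-represents n m c (lookup ρ 0F) in
      ⇔-sym (<⇔cross rp (natural-represents (lookup ρ 1F)) ×-⇔ ≤⇔cross (natural-represents (lookup ρ 1F ∸ 1)) rp))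
    (1 *ᴬ n *ᴬ # 0F <ᴬ suc m *ᴬ # 1F ∧ᴬ suc m *ᴬ predᴬ (# 1F) ≤ᴬ 1 *ᴬ n *ᴬ # 0F)

-- Decision procedures

∃-cong⇔ : ∀ {X : Set} {P Q : X → Set} → (∀ x → P x ⇔ Q x) → ∃ P ⇔ ∃ Q
∃-cong⇔ h = mk⇔ (map₂ (to (h _))) (map₂ (from (h _)))

∀-cong⇔ : ∀ {X : Set} {P Q : X → Set} → (∀ x → P x ⇔ Q x) → (∀ x → P x) ⇔ (∀ x → Q x)
∀-cong⇔ h = mk⇔ (λ p x → to (h x) (p x)) (λ q x → from (h x) (q x))

module Decisions (b d : ℕ) (M : DFAO (suc (suc b)) d) (a : ℕ → Fin d) (gen : Generates M a) where

  open Automata b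
  open Arithmetic b
  open Sequence b d M a gen

  module Powers (B : ℕ → ℕ → Set) (B⇒≤ : ∀ p L → B p L → p ≤ L)
                (B-automatic : Automatic {2} (λ ρ → B (lookup ρ 0F) (lookup ρ 1F))) where

    Power : List (Fin d) → Set
    Power z = ∃[ x ] PowerOf B x z

    LongPower : ℕ → List (Fin d) → Set
    LongPower l z = ∃[ x ] (l ≤ length x × PowerOf B x z)

    LongPower⇔ : ∀ l i L → LongPower l (factorAt a i L) ⇔ HasPowerAt B a l i L
    LongPower⇔ = PowerOf⇔HasPowerAt B⇒≤ a

    Power⇔ : ∀ i L → Power (factorAt a i L) ⇔ HasPowerAt B a 0 i L
    Power⇔ i L = LongPower⇔ 0 i L ⇔-∘ mk⇔ (map₂ (z≤n ,_)) (map₂ proj₂)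

    hasPowerAt : ∀ {n} {l i L : Vec ℕ n → ℕ} → AutomaticFun l → AutomaticFun i → AutomaticFun L →
                 Automatic (λ ρ → HasPowerAt B a (l ρ) (i ρ) (L ρ))
    hasPowerAt l i L = ∃ᴬ
      (#1 ≤ᴬ # 0F ∧ᴬ weaken l ≤ᴬ # 0F ∧ᴬ substitute₂ (# 0F) (weaken L) B-automatic ∧ᴬ
       -- Here `# 0F` is the position `j` inside the factor and `# 1F` the period.
       (∀ᴬ (# 0F +ᴬ # 1F <ᴬ weaken (weaken L) ⇒ᴬ
            letters Fin._≟_ (weaken (weaken i) +ᴬ # 0F) (weaken (weaken i) +ᴬ (# 0F +ᴬ # 1F)))))

    -- The bound on the period stays a free variable: it can be given a value, or be quantified to
    -- express eventual avoidance.
    avoids-long : Automatic {1} (λ ρ → ¬ (∃₂ λ i L → HasPowerAt B a (lookup ρ 0F) i L))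
    avoids-long = ¬ᴬ (∃ᴬ (∃ᴬ hasPowerAt (# 2F) (# 1F) (# 0F)))

    avoids-long⇔ : ∀ l → Avoids a (LongPower l) ⇔ (¬ (∃₂ λ i L → HasPowerAt B a l i L))
    avoids-long⇔ l = ¬-cong ((∃-cong⇔ λ i → ∃-cong⇔ λ L → LongPower⇔ l i L) ⇔-∘ Contains⇔ a)

    avoids-long? : ∀ l → Dec (Avoids a (LongPower l))
    avoids-long? l = Dec.map (⇔-sym (avoids-long⇔ l)) (dec avoids-long (l ∷ []))

    avoids? : Dec (Avoids a Power)
    avoids? = Dec.map (⇔-sym (¬-cong ((∃-cong⇔ λ i → ∃-cong⇔ λ L → Power⇔ i L) ⇔-∘ Contains⇔ a)))
                      (dec avoids-long (0 ∷ []))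

    eventually-avoids? : Dec (∃[ l ] Avoids a (LongPower l))
    eventually-avoids? = Dec.map (⇔-sym (∃-cong⇔ avoids-long⇔)) (dec (∃ᴬ avoids-long) [])

    -- An occurrence is measured by its end `i + L`, which finitely many occurrences keep below a
    -- given bound.
    infinitely-often? : Dec (Infinite (Occurrence a Power))
    infinitely-often? = Dec.map
      (⇔-sym ((∀-cong⇔ λ N → mk⇔ (λ { ((i , L) , le , h) → i , L , le , to (Power⇔ i L) h })
                                 (λ { (i , L , le , h) → (i , L) , le , from (Power⇔ i L) h }))
              ⇔-∘ Infinite⇔unbounded (uncurry _+_) _ ∈-pairs))
      (dec (∀ᴬ (∃ᴬ (∃ᴬ (# 2F ≤ᴬ # 1F +ᴬ # 0F ∧ᴬ hasPowerAt #0 (# 1F) (# 0F))))) [])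

    -- Distinct words are measured by length: the alphabet is finite, so only finitely many are
    -- shorter than a given bound.
    infinitely-many? : Dec (Infinite (λ w → IsFactor a w × Power w))
    infinitely-many? = Dec.map
      (⇔-sym ((∀-cong⇔ λ N → mk⇔ forth back) ⇔-∘ Infinite⇔unbounded length _ ∈-words))
      (dec (∀ᴬ (∃ᴬ (∃ᴬ (# 2F ≤ᴬ # 0F ∧ᴬ hasPowerAt #0 (# 1F) (# 0F))))) [])
      where
      forth : ∀ {N} → (∃[ w ] (N ≤ length w × IsFactor a w × Power w)) →
              ∃₂ λ i L → N ≤ L × HasPowerAt B a 0 i L
      forth (w , le , (i , eq) , h) = i , length w , le , to (Power⇔ i (length w)) (subst Power eq h)
      back : ∀ {N} → (∃₂ λ i L → N ≤ L × HasPowerAt B a 0 i L) →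
             ∃[ w ] (N ≤ length w × IsFactor a w × Power w)
      back {N} (i , L , le , h) = factorAt a i L , subst (N ≤_) (sym (length-factorAt a i L)) le
                                , factorAt-isFactor a i L , from (Power⇔ i L) h

  Mirrored : ℕ → ℕ → ℕ → Set
  Mirrored i i′ L = ∀ j j′ → j + suc j′ ≡ L → a (i′ + j) ≡ a (i + j′)

  mirrored : ∀ {n} {i i′ L : Vec ℕ n → ℕ} → AutomaticFun i → AutomaticFun i′ → AutomaticFun L →
             Automatic (λ ρ → Mirrored (i ρ) (i′ ρ) (L ρ))
  mirrored i i′ L = ∀ᴬ (∀ᴬ (# 1F +ᴬ (#1 +ᴬ # 0F) ≡ᴬ weaken (weaken L) ⇒ᴬ
    letters Fin._≟_ (weaken (weaken i′) +ᴬ # 1F) (weaken (weaken i) +ᴬ # 0F)))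

  reverse-factorAt⇔ : ∀ i i′ L → reverse (factorAt a i L) ≡ factorAt a i′ L ⇔ Mirrored i i′ L
  reverse-factorAt⇔ i i′ L
    rewrite List.map-upTo (λ j → a (i + j)) L | List.map-upTo (λ j → a (i′ + j)) L = reverse-applyUpTo⇔ _ _ L

  LongPalindrome : ℕ → List (Fin d) → Set
  LongPalindrome l w = IsPalindrome w × l ≤ length w

  avoids-palindromes : Automatic {1} (λ ρ → ¬ (∃₂ λ i L → Mirrored i i L × lookup ρ 0F ≤ L))
  avoids-palindromes = ¬ᴬ (∃ᴬ (∃ᴬ (mirrored (# 1F) (# 1F) (# 0F) ∧ᴬ # 2F ≤ᴬ # 0F)))

  avoids-palindromes⇔ : ∀ l → Avoids a (LongPalindrome l) ⇔ (¬ (∃₂ λ i L → Mirrored i i L × l ≤ L))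
  avoids-palindromes⇔ l = ¬-cong ((∃-cong⇔ λ i → ∃-cong⇔ λ L → palindrome⇔ i L) ⇔-∘ Contains⇔ a)
    where
    palindrome⇔ : ∀ i L → LongPalindrome l (factorAt a i L) ⇔ (Mirrored i i L × l ≤ L)
    palindrome⇔ i L = reverse-factorAt⇔ i i L ×-⇔ subst (λ n → l ≤ n ⇔ l ≤ L) (sym (length-factorAt a i L)) (⇔-id _)

  avoids-palindromes? : ∀ l → Dec (Avoids a (LongPalindrome l))
  avoids-palindromes? l = Dec.map (⇔-sym (avoids-palindromes⇔ l)) (dec avoids-palindromes (l ∷ []))

  eventually-avoids-palindromes? : Dec (∃[ l ] Avoids a (LongPalindrome l))
  eventually-avoids-palindromes? = Dec.map (⇔-sym (∃-cong⇔ avoids-palindromes⇔)) (dec (∃ᴬ avoids-palindromes) [])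

  -- A counterexample amounts to two intervals of equal length, at least `l`, that mirror each
  -- other; this removes the quantifier over words.
  no-reversed-factor? : ∀ l → Dec (∀ x → IsFactor a x → l ≤ length x → ¬ IsFactor a (reverse x))
  no-reversed-factor? l = Dec.map′ forth back
    (dec {1} (¬ᴬ (∃ᴬ (∃ᴬ (∃ᴬ (# 3F ≤ᴬ # 0F ∧ᴬ mirrored (# 2F) (# 1F) (# 0F)))))) (l ∷ []))
    where
    MirroredPair : Set
    MirroredPair = ∃[ i ] ∃[ i′ ] ∃[ L ] (l ≤ L × Mirrored i i′ L)
    forth : ¬ MirroredPair → ∀ x → IsFactor a x → l ≤ length x → ¬ IsFactor a (reverse x)
    forth h x (i , eq) le (i′ , eq′) = h (i , i′ , length x , le , to (reverse-factorAt⇔ i i′ (length x))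
      (trans (cong reverse (sym eq)) (trans eq′ (cong (factorAt a i′) (List.length-reverse x)))))
    back : (∀ x → IsFactor a x → l ≤ length x → ¬ IsFactor a (reverse x)) → ¬ MirroredPair
    back h (i , i′ , L , le , m) =
      h (factorAt a i L) (factorAt-isFactor a i L) (subst (l ≤_) (sym (length-factorAt a i L)) le)
        (i′ , trans (from (reverse-factorAt⇔ i i′ L) m)
                    (cong (factorAt a i′) (sym (trans (List.length-reverse (factorAt a i L)) (length-factorAt a i L)))))

  avoids-σ-squares? : Dec (Avoids a (λ z → ∃[ x ] (x ≢ [] × z ≡ x ++ σ* x)))
  avoids-σ-squares? = Dec.map
    (⇔-sym (¬-cong ((∃-cong⇔ λ i → ∃-cong⇔ λ L → square⇔ i L) ⇔-∘ Contains⇔ a)))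
    (dec (¬ᴬ (∃ᴬ (∃ᴬ (∃ᴬ (#1 ≤ᴬ # 0F ∧ᴬ # 0F +ᴬ # 0F ≡ᴬ # 1F ∧ᴬ
      -- The variables `# 0F` to `# 3F` are the offset `j`, the half length `p`, the length `L` and
      -- the start `i`.
      (∀ᴬ (# 0F <ᴬ # 1F ⇒ᴬ letters (λ e e′ → σ e Fin.≟ e′) (# 3F +ᴬ # 0F) (# 3F +ᴬ (# 1F +ᴬ # 0F))))))))) [])
    where
    square⇔ : ∀ i L → (∃[ x ] (x ≢ [] × factorAt a i L ≡ x ++ σ* x)) ⇔
              (∃[ p ] (1 ≤ p × p + p ≡ L × (∀ j → j < p → σ (a (i + j)) ≡ a (i + (p + j)))))
    square⇔ i L rewrite List.map-upTo (λ j → a (i + j)) L = applyUpTo-map-square⇔ (λ j → a (i + j)) σ L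

theorem3 :
    ∀ (k : ℕ) → 2 ≤ k →
    ∀ (d : ℕ) (M : DFAO k d) (a : ℕ → Fin d) → Generates M a →
    -- (a) avoiding r-powers / r⁺-powers
    (∀ (r : ℚ) → 1ℚ ℚ.< r →
      Dec (Avoids a (IsPower r)) × Dec (Avoids a (IsPowerPlus r)))
    -- (b) infinitely many occurrences of r-powers / r⁺-powers
    × (∀ (r : ℚ) → 1ℚ ℚ.< r →
      Dec (Infinite (Occurrence a (IsPower r)))
      × Dec (Infinite (Occurrence a (IsPowerPlus r))))
    -- (c) infinitely many distinct r-powers / r⁺-powers
    × (∀ (r : ℚ) → 1ℚ ℚ.< r →
      Dec (Infinite (λ w → IsFactor a w × IsPower r w))
      × Dec (Infinite (λ w → IsFactor a w × IsPowerPlus r w)))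
    -- (d) avoiding r-powers / r⁺-powers with period word of length ≥ l
    × (∀ (r : ℚ) → 1ℚ ℚ.< r → ∀ (l : ℕ) →
      Dec (Avoids a (λ z → ∃[ x ] (l ≤ length x × IsPowerOf r x z)))
      × Dec (Avoids a (λ z → ∃[ x ] (l ≤ length x × IsPowerPlusOf r x z))))
    -- (e) avoiding x^r for all sufficiently long x
    × (∀ (r : ℚ) → 1ℚ ℚ.< r →
      Dec (∃[ l ] Avoids a (λ z → ∃[ x ] (l ≤ length x × IsPowerOf r x z))))
    -- (f) avoiding palindromes of length ≥ l
    × (∀ (l : ℕ) → Dec (Avoids a (λ w → IsPalindrome w × l ≤ length w)))
    -- (g) avoiding all sufficiently long palindromes
    × Dec (∃[ l ] Avoids a (λ w → IsPalindrome w × l ≤ length w))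
    -- (h) no factor of length ≥ l has its reversal as a factor
    × (∀ (l : ℕ) →
      Dec (∀ (x : List (Fin d)) → IsFactor a x → l ≤ length x → ¬ IsFactor a (reverse x)))
    -- (i) (alphabet {0,…,d-1}) no factor x σ(x) with x nonempty
    × Dec (Avoids a (λ z → ∃[ x ] (x ≢ [] × z ≡ x ++ σ* x)))
theorem3 zero          ()
theorem3 (suc zero)    (s≤s ())
theorem3 (suc (suc b)) _ d M a gen =
    (λ r 1<r → ≥r.avoids? r 1<r , >r.avoids? r 1<r)
  , (λ r 1<r → ≥r.infinitely-often? r 1<r , >r.infinitely-often? r 1<r)
  , (λ r 1<r → ≥r.infinitely-many? r 1<r , >r.infinitely-many? r 1<r)
  , (λ r 1<r l → ≥r.avoids-long? r 1<r l , >r.avoids-long? r 1<r l)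
  , (λ r 1<r → ≥r.eventually-avoids? r 1<r)
  , avoids-palindromes?
  , eventually-avoids-palindromes?
  , no-reversed-factor?
  , avoids-σ-squares?
  where
  open Decisions b d M a gen
  open Bounds b
  module ≥r (r : ℚ) (1<r : 1ℚ ℚ.< r) =
    Powers (PowerLength r) (λ p L (rp≤L , _) → multiple-≤⇒≤ 1<r rp≤L) (PowerLength-automatic r 1<r)
  module >r (r : ℚ) (1<r : 1ℚ ℚ.< r) =
    Powers (PowerPlusLength r) (λ p L (rp<L , _) → multiple-≤⇒≤ 1<r (ℚ.<⇒≤ rp<L)) (PowerPlusLength-automatic r 1<r)
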